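{- For oracles $\chi:A\to\nabla_0B$ and $\chi':A'\to\nabla_0B'$, if $\chi\le_{\mathrm{wtt}}\chi'$ then $\chi\le_T\chi'$.
   Context: Setting: homotopy type theory with a univalent universe $\mathcal{U}$ of small types and higher inductive types. It is assumed that there is a small type $\Omega_{\neg\neg}:\mathcal{U}$ classifying $\neg\neg$-stable propositions. For a type $X$, $\nabla_0X$ is the type of $\xi:X\to\Omega_{\neg\neg}$ such that $\neg\neg\sum_{x:X}\xi(x)$ and $\prod_{x,y:X}\xi(x)\to\xi(y)\to\neg\neg(x=y)$; write $\xi\downarrow:=\sum_{x:X}\xi(x)$. For a higher modality $\bigcirc$, a type $X$ is $\bigcirc$-connected if $\bigcirc X$ is contractible. For a family $B:A\to\mathcal{U}$, the nullification at $B$ is the higher modality whose modal types are exactly the $X$ such that for every $a$ the constant map $X\to X^{B(a)}$ is an equivalence. An oracle is a map $\chi:A\to\nabla_0B$; the oracle modality $\bigcirc_\chi$ is the nullification at the family $a\mapsto\chi(a)\downarrow$. For higher modalities, $\bigcirc\le_T\Diamond$ means every $\bigcirc$-connected type is $\Diamond$-connected; $\chi\le_T\chi'$ means $\bigcirc_\chi\le_T\bigcirc_{\chi'}$. We say $\chi\le_{\mathrm{wtt}}\chi'$ if there is a function $f:A\to\mathtt{List}(A')$ such that for all $x:A$, if $\chi'(y)\downarrow$ for every element $y$ of the list $f(x)$, then $\chi(x)\downarrow$.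
   Formalization: The formal statement additionally assumes that χ(a)↓ is a proposition for every a in A (automatic when B is ¬¬-separated); for arbitrary B the claim fails, e.g. B the circle, A = 1, ξ constantly true, A′ empty. -}

{-# OPTIONS --without-K #-}
module Defs where

open import Level using (Level) renaming (suc to lsuc)
open import Data.List.Base using (List)
open import Data.List.Relation.Unary.All using (All)
open import Data.Product.Base using (Σ-syntax; _×_; _,_; proj₁; proj₂)
open import Function.Base using (const)
open import Function.Bundles using (_⇔_)
open import Relation.Binary.PropositionalEquality using (_≡_; refl)
open import Relation.Nullary using (¬_; Irrelevant; Stable)

private
  variable
    a b ℓ : Level

-- The universe 𝒰 is Set ℓ, and the homotopy propositions are the types
-- satisfying the library's `Irrelevant`.  Everything is developed --without-K.

isContr : Set a → Set a
isContr A = Σ[ x ∈ A ] (∀ y → x ≡ y)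

-- Contractible fibres, so that being an equivalence is a proposition.
IsEquiv : {A : Set a} {B : Set b} → (A → B) → Set _
IsEquiv {A = A} f = ∀ y → isContr (Σ[ x ∈ A ] f x ≡ y)

-- Higher modalities in the sense of the HoTT Book (Definition 7.7.5) and of
-- Rijke–Shulman–Spitters.

record HigherModality (ℓ : Level) : Set (lsuc ℓ) where
  field
    ◯       : Set ℓ → Set ℓ
    η       : {A : Set ℓ} → A → ◯ A
    ◯-ind   : {A : Set ℓ} (B : ◯ A → Set ℓ) →
              (∀ x → ◯ (B (η x))) → ∀ z → ◯ (B z)
    ◯-β     : {A : Set ℓ} (B : ◯ A → Set ℓ) (f : ∀ x → ◯ (B (η x))) →
              ∀ x → ◯-ind B f (η x) ≡ f x
    ◯-≡     : {A : Set ℓ} (z z′ : ◯ A) → IsEquiv (η {A = z ≡ z′})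

  IsModal : Set ℓ → Set ℓ
  IsModal X = IsEquiv (η {A = X})

  IsConnected : Set ℓ → Set ℓ
  IsConnected X = isContr (◯ X)

open HigherModality using (IsModal; IsConnected)

_≤ᴹ_ : HigherModality ℓ → HigherModality ℓ → Set (lsuc ℓ)
M ≤ᴹ N = ∀ X → IsConnected M X → IsConnected N X

IsNull : {A : Set ℓ} → (A → Set ℓ) → Set ℓ → Set ℓ
IsNull B X = ∀ a → IsEquiv {A = X} {B = B a → X} const

-- Plain Agda has no higher inductive types with which to construct the
-- nullification at B, so it is specified by its defining property, which
-- determines the modality up to equivalence.
record Nullification {A : Set ℓ} (B : A → Set ℓ) : Set (lsuc ℓ) where
  field
    modality   : HigherModality ℓ
    modal⇔null : ∀ X → IsModal modality X ⇔ IsNull B X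

open Nullification using (modality)

-- A type in Set ℓ (not merely in Set (lsuc ℓ)) equivalent to the type of all
-- ¬¬-stable propositions in Set ℓ.
record StableClassifier (ℓ : Level) : Set (lsuc ℓ) where
  field
    Ω¬¬       : Set ℓ
    classify  : Ω¬¬ → Σ[ P ∈ Set ℓ ] (Irrelevant P × Stable P)
    classify≃ : IsEquiv classify

  El : Ω¬¬ → Set ℓ
  El ω = proj₁ (classify ω)

  El-irrelevant : ∀ ω → Irrelevant (El ω)
  El-irrelevant ω = proj₁ (proj₂ (classify ω))

module Oracles (Ω : StableClassifier ℓ) where
  open StableClassifier Ω

  record ∇₀ (X : Set ℓ) : Set ℓ where
    field
      ξ      : X → Ω¬¬
      exists : ¬ ¬ (Σ[ x ∈ X ] El (ξ x))
      unique : ∀ x y → El (ξ x) → El (ξ y) → ¬ ¬ (x ≡ y)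

    _↓ : Set ℓ
    _↓ = Σ[ x ∈ X ] El (ξ x)

  open ∇₀ public using (_↓)

  Oracle : Set ℓ → Set ℓ → Set ℓ
  Oracle A B = A → ∇₀ B

  private
    variable
      A B A′ B′ : Set ℓ

  OracleModality : Oracle A B → Set (lsuc ℓ)
  OracleModality χ = Nullification (λ a → χ a ↓)

  -- Turing reducibility does not depend on which model of the two
  -- nullifications is used, since each is determined by its modal types.
  _≤T_ : Oracle A B → Oracle A′ B′ → Set (lsuc ℓ)
  χ ≤T χ′ = (◯χ : OracleModality χ) (◯χ′ : OracleModality χ′) →
            modality ◯χ ≤ᴹ modality ◯χ′

  _≤wtt_ : Oracle A B → Oracle A′ B′ → Set ℓ
  _≤wtt_ {A = A} {A′ = A′} χ χ′ =
    Σ[ f ∈ (A → List A′) ] (∀ x → All (λ y → χ′ y ↓) (f x) → χ x ↓)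

  -- The type ξ ↓ need not be a proposition: for the constantly true ξ on the
  -- circle it is the circle.  It is one when the codomain is ¬¬-separated.
  separated⇒↓-irrelevant : (∀ (x y : B) → Stable (x ≡ y)) →
                           (u : ∇₀ B) → Irrelevant (u ↓)
  separated⇒↓-irrelevant sep u (x , p) (y , q)
    with refl ← sep x y (∇₀.unique u x y p q)
    with refl ← El-irrelevant (∇₀.ξ u x) p q = refl

{-# OPTIONS --without-K #-}
module Submission where

open import Axiom.Extensionality.Propositional using (Extensionality)
open import Data.List.Base using ([]; _∷_)
open import Data.List.Relation.Unary.All using (All; []; _∷_)
open import Data.Product.Base using (Σ-syntax; _,_; proj₁; proj₂)
open import Function.Base using (const; _∘_)
open import Function.Bundles using (Equivalence; mk↔ₛ′)
open import Function.Properties.Inverse.HalfAdjointEquivalence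
  using (module _≃_; ↔⇒≃)
open import Level using (Level)
open import Relation.Binary.PropositionalEquality
  using (_≡_; refl; trans; cong; module ≡-Reasoning)
open import Relation.Nullary using (Irrelevant)
open import Defs

-- A χ′-modal type X is null at every χ′(y)↓, hence at any finite product Q of
-- these.  If Q maps to a proposition P, then X is also null at P: the value of
-- g : P → X is read off from Q → P → X, and it agrees with g p because g is
-- constant once P is inhabited.  Hence every type modal for χ′ is modal for χ.
-- If Y is χ-connected, the unit Y → ◯χ′ Y therefore factors through a
-- contractible type, so it is constant, and ◯-induction contracts ◯χ′ Y.

private
  variable
    a b ℓ : Level

module _ {A : Set a} {B : Set b} {f : A → B} where

  -- Contracting a fibre needs the two homotopies to be coherent, so the inverse is first adjusted
  -- to a half adjoint one, which supplies `triangle`.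
  quasiInverse⇒IsEquiv : (g : B → A) → (∀ y → f (g y) ≡ y) →
                         (∀ x → g (f x) ≡ x) → IsEquiv f
  quasiInverse⇒IsEquiv g fg gf y = (from y , right y) , contract
    where
    open _≃_ (↔⇒≃ (mk↔ₛ′ f g fg gf)) using (from) renaming
      (left-inverse-of to left; right-inverse-of to right;
       left-right to triangle)

    contract : (p : Σ[ x ∈ A ] f x ≡ y) → (from y , right y) ≡ p
    contract (x , refl) = shift (left x) (right (f x)) (triangle x)
      where
      -- With the endpoint `x′` and the path `q` kept general, path induction applies to `p` and
      -- then to the triangle, without K.
      shift : ∀ {x′} (p : x′ ≡ x) (q : f x′ ≡ f x) → cong f p ≡ q →
              _≡_ {A = Σ[ z ∈ A ] f z ≡ f x} (x′ , q) (x , refl)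
      shift refl _ refl = refl

  module _ (e : IsEquiv f) where

    inverse : B → A
    inverse y = proj₁ (proj₁ (e y))

    inverseʳ : ∀ y → f (inverse y) ≡ y
    inverseʳ y = proj₂ (proj₁ (e y))

    inverseˡ : ∀ x → inverse (f x) ≡ x
    inverseˡ x = cong proj₁ (proj₂ (e (f x)) (x , refl))

NullAt : Set ℓ → Set ℓ → Set ℓ
NullAt X Q = IsEquiv {A = X} {B = Q → X} const

module _ (funext : Extensionality ℓ ℓ) {X : Set ℓ} where

  private
    mkNullAt : {Q : Set ℓ} (s : (Q → X) → X) → (∀ g q → s g ≡ g q) →
               (∀ x → s (const x) ≡ x) → NullAt X Q
    mkNullAt s s-value = quasiInverse⇒IsEquiv s (λ g → funext (s-value g))

    inverse-value : {Q : Set ℓ} (n : NullAt X Q) (g : Q → X) →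
                    ∀ q → inverse n g ≡ g q
    inverse-value n g q = cong (λ h → h q) (inverseʳ n g)

  -- Induction on the list: `All P []` has one element, and a map out of `All P (y ∷ ys)` curries,
  -- so its value is extracted over the tail and then over the head.
  null-All : {A : Set ℓ} {P : A → Set ℓ} → IsNull P X →
             ∀ xs → NullAt X (All P xs)
  null-All null [] = mkNullAt (λ g → g []) (λ { g [] → refl }) (λ _ → refl)
  null-All {P = P} null (y ∷ ys) = mkNullAt s s-value s-const
    where
    ih : NullAt X (All P ys)
    ih = null-All null ys

    s : (All P (y ∷ ys) → X) → X
    s g = inverse (null y) λ p → inverse ih λ ps → g (p ∷ ps)

    s-value : ∀ g ps → s g ≡ g ps
    s-value g (p ∷ ps) =
      trans (inverse-value (null y) _ p) (inverse-value ih _ ps)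

    s-const : ∀ x → s (const x) ≡ x
    s-const x = trans (cong (inverse (null y)) (funext λ _ → inverseˡ ih x))
                      (inverseˡ (null y) x)

  null-map : {P Q : Set ℓ} → Irrelevant P → (Q → P) → NullAt X Q → NullAt X P
  -- `const x ∘ q` computes to `const x`, so `inverseˡ n` serves unchanged as the law for constant
  -- maps.
  null-map irr q n = mkNullAt (λ g → inverse n (g ∘ q)) value (inverseˡ n)
    where
    value : ∀ g p → inverse n (g ∘ q) ≡ g p
    value g p = trans (cong (inverse n) (funext λ z → cong g (irr (q z) p)))
                      (inverseˡ n (g p))

module _ (M : HigherModality ℓ) where
  open HigherModality M using (◯; η; ◯-ind; ◯-β; ◯-≡; IsModal; IsConnected)

  -- Identity types of `◯ Y` are modal by `◯-≡`, so an equality obtained under `◯` by induction can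
  -- be brought out.
  ◯-ind-≡ : {X Y : Set ℓ} (f g : ◯ X → ◯ Y) → (∀ x → f (η x) ≡ g (η x)) →
            ∀ z → f z ≡ g z
  ◯-ind-≡ f g h z =
    inverse (◯-≡ (f z) (g z)) (◯-ind (λ z → f z ≡ g z) (η ∘ h) z)

  ◯-modal : (X : Set ℓ) → IsModal (◯ X)
  ◯-modal X = quasiInverse⇒IsEquiv join
    (◯-ind-≡ (η ∘ join) (λ z → z) (λ x → cong η (join-η x))) join-η
    where
    join : ◯ (◯ X) → ◯ X
    join = ◯-ind (λ _ → X) (λ x → x)

    join-η : ∀ x → join (η x) ≡ x
    join-η = ◯-β (λ _ → X) (λ x → x)

  connected⇒constant : {X Y : Set ℓ} → IsConnected X → IsModal Y → (f : X → Y) →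
                       Σ[ y ∈ Y ] (∀ x → y ≡ f x)
  connected⇒constant {X} {Y} (c , contract) modal f = extend c , λ x → begin
    extend c                ≡⟨ cong extend (contract (η x)) ⟩
    extend (η x)            ≡⟨ cong (inverse modal) (◯-β (λ _ → Y) (η ∘ f) x) ⟩
    inverse modal (η (f x)) ≡⟨ inverseˡ modal (f x) ⟩
    f x                     ∎
    where
    open ≡-Reasoning

    extend : ◯ X → Y
    -- Recursion only lands in `◯ Y`; modality of `Y` brings the value back.
    extend = inverse modal ∘ ◯-ind (λ _ → Y) (η ∘ f)

modal⊆⇒≤ᴹ : (M N : HigherModality ℓ) →
  (∀ X → HigherModality.IsModal N X → HigherModality.IsModal M X) → M ≤ᴹ N
modal⊆⇒≤ᴹ M N N⇒M X conn = c , ◯-ind-≡ N (const c) (λ z → z) constant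
  where
  open HigherModality N using (◯; η)

  unit-constant : Σ[ c ∈ ◯ X ] (∀ x → c ≡ η x)
  -- Two modalities meet here: `η` is the unit of `N`, but its codomain is also `M`-modal, so
  -- `M`-connectedness of `X` applies to it.
  unit-constant = connected⇒constant M conn (N⇒M (◯ X) (◯-modal N X)) η

  c : ◯ X
  c = proj₁ unit-constant

  constant : ∀ x → c ≡ η x
  constant = proj₂ unit-constant

mainTheorem8 : ∀ {ℓ} → Extensionality ℓ ℓ → (Ω : StableClassifier ℓ) →
    let open Oracles Ω in
    {A B A′ B′ : Set ℓ} (χ : Oracle A B) (χ′ : Oracle A′ B′) →
    (∀ a → Irrelevant (χ a ↓)) →
    χ ≤wtt χ′ → χ ≤T χ′
mainTheorem8 funext Ω χ χ′ irr (f , reduce) ◯χ ◯χ′ =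
  modal⊆⇒≤ᴹ (modality ◯χ) (modality ◯χ′) λ X modal →
    Equivalence.from (modal⇔null ◯χ X) λ a →
      -- The finite product is taken over the query list `f a`, and `reduce a` maps it to `χ a ↓`.
      null-map funext (irr a) (reduce a)
        (null-All funext (Equivalence.to (modal⇔null ◯χ′ X) modal) (f a))
  where open Nullification using (modality; modal⇔null)
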